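{- Let $k \ge 2$ be an integer and let $G^L(k) = (C \cup (V\setminus C), E)$ be any graph with vertex set $V$ and $C\subseteq V$ such that $|C| = k$ and $V \setminus C$ consists of exactly one vertex $v_{C'}$ with $N(v_{C'}) \cap C = C'$ for each non-empty subset $C' \subseteq C$ (with no condition on the edges inside $C$ or inside $V\setminus C$). Then in $G^L(k)$, the set $C$ is a minimum-cardinality (i) LD-code; (ii) LTD-code if $G^L(k)[C]$ has no isolated vertex, that is, if $G^L(k)[C]$ is LTD-admissible. Moreover, for $X \in \{\mathrm{LD}, \mathrm{LTD}\}$, the minimum X-density among all X-admissible graphs with X-number $k$ is attained by any graph $G^L(k)$ if $X=\mathrm{LD}$, and by those graphs $G^L(k)$ for which $G^L(k)[C]$ has no isolated vertex if $X=\mathrm{LTD}$.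
   Context: Graphs are finite, simple and undirected. For a graph $G=(V,E)$ and $v\in V$, $N(v)$ is the open neighborhood and $N[v]=N(v)\cup\{v\}$ the closed neighborhood; $G[C]$ is the subgraph induced by $C$. A set $C\subseteq V$ is dominating (resp. total-dominating) if $N[v]\cap C\neq\emptyset$ (resp. $N(v)\cap C\ne\emptyset$) for all $v\in V$. A set $C$ is location-separating if $N(u)\cap C\neq N(v)\cap C$ for all distinct $u,v\in V\setminus C$. An LD-code (resp. LTD-code) is a set that is location-separating and dominating (resp. total-dominating). A graph is X-admissible if it has an X-code; the X-number $\gamma^{X}(G)$ of an X-admissible graph is the minimum cardinality of an X-code of $G$. The X-density of an X-admissible graph $G$ on $n$ vertices is $\gamma^{X}(G)/n$. -}

module Defs where

open import Data.Fin.Base using (Fin; zero; suc)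
open import Data.Fin.Subset using (Subset; inside; outside; _∉_; _⊆_; _∩_; _∪_; ⁅_⁆; ∣_∣; Nonempty; Empty)
open import Data.Integer.Base using (+_)
open import Data.Nat.Base using (ℕ; NonZero; _≤_)
open import Data.Product.Base using (∃; Σ; _×_)
open import Data.Product using (∃!)
open import Data.Rational.Base as ℚ using (ℚ)
open import Data.Vec.Base using (_∷_; tabulate)
open import Function.Base using (_∘_)
open import Level using (0ℓ)
open import Relation.Binary.Core using (Rel)
open import Relation.Binary.Definitions using (Decidable; Irreflexive; Symmetric)
open import Relation.Binary.PropositionalEquality using (_≡_; _≢_; cong)
open import Relation.Nullary.Decidable.Core using (does)
open import Relation.Nullary.Negation.Core using (¬_)

record Graph (n : ℕ) : Set₁ where
  field
    _~_      : Rel (Fin n) 0ℓ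
    ~-sym    : Symmetric _~_
    ~-irrefl : Irreflexive _≡_ _~_
    _~?_     : Decidable _~_

  N : Fin n → Subset n
  N v = tabulate (does ∘ (v ~?_))

  N[_] : Fin n → Subset n
  N[ v ] = N v ∪ ⁅ v ⁆

  Isolated : Fin n → Set
  Isolated v = Empty (N v)

  NoIsolated : Set
  NoIsolated = ∀ v → ¬ Isolated v

  Dominating : Subset n → Set
  Dominating C = ∀ v → Nonempty (N[ v ] ∩ C)

  TotalDominating : Subset n → Set
  TotalDominating C = ∀ v → Nonempty (N v ∩ C)

  LocationSeparating : Subset n → Set
  LocationSeparating C = ∀ {u v} → u ∉ C → v ∉ C → u ≢ v → N u ∩ C ≢ N v ∩ C

open Graph public using (NoIsolated)

-- The elements of C in increasing order.
enum : ∀ {n} (C : Subset n) → Fin ∣ C ∣ → Fin n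
enum (inside  ∷ C) zero    = zero
enum (inside  ∷ C) (suc i) = suc (enum C i)
enum (outside ∷ C) i       = suc (enum C i)

-- The induced subgraph, with the vertex set C relabelled along enum.
induced : ∀ {n} → Graph n → (C : Subset n) → Graph ∣ C ∣
induced G C = record
  { _~_      = λ i j → enum C i ~ enum C j
  ; ~-sym    = ~-sym
  ; ~-irrefl = ~-irrefl ∘ cong (enum C)
  ; _~?_     = λ i j → enum C i ~? enum C j
  }
  where open Graph G

data CodeKind : Set where
  LD LTD : CodeKind

IsCode : CodeKind → ∀ {n} → Graph n → Subset n → Set
IsCode LD  G C = Graph.LocationSeparating G C × Graph.Dominating G C
IsCode LTD G C = Graph.LocationSeparating G C × Graph.TotalDominating G C

Admissible : CodeKind → ∀ {n} → Graph n → Set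
Admissible X G = ∃ (IsCode X G)

IsMinimumCode : CodeKind → ∀ {n} → Graph n → Subset n → Set
IsMinimumCode X G C = IsCode X G C × (∀ D → IsCode X G D → ∣ C ∣ ≤ ∣ D ∣)

-- HasNumber X G γ : G is X-admissible and γ is its X-number.
HasNumber : CodeKind → ∀ {n} → Graph n → ℕ → Set
HasNumber X G γ = ∃ λ C → IsMinimumCode X G C × ∣ C ∣ ≡ γ

-- The X-density is only defined for graphs with at least one vertex; a
-- graph whose X-number is positive always has one.
HasDensity : CodeKind → ∀ {n} → Graph n → ℚ → Set
HasDensity X {n} G q =
  ∃ λ γ → HasNumber X G γ × Σ (NonZero n) λ n≢0 → q ≡ ℚ._/_ (+ γ) n {{n≢0}}

-- Among all X-admissible graphs with X-number k (on any number of
-- vertices), G has minimum X-density.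
AttainsMinimumDensity : CodeKind → ℕ → ∀ {n} → Graph n → Set₁
AttainsMinimumDensity X k G =
  Admissible X G × HasNumber X G k × ∃ λ q → HasDensity X G q ×
  (∀ {m} (H : Graph m) → Admissible X H → HasNumber X H k →
   ∀ r → HasDensity X H r → q ℚ.≤ r)

-- G is a graph G^L(k) with respect to C: sending v to N(v) ∩ C is a
-- bijection from V ∖ C onto the non-empty subsets of C.
record IsGL (k : ℕ) {n : ℕ} (G : Graph n) (C : Subset n) : Set where
  open Graph G using (N)
  field
    size      : ∣ C ∣ ≡ k
    unique-v  : ∀ C′ → C′ ⊆ C → Nonempty C′ →
                ∃! _≡_ λ v → v ∉ C × N v ∩ C ≡ C′
    exhausted : ∀ v → v ∉ C → Nonempty (N v ∩ C)

{-# OPTIONS --safe #-}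

-- Fix a set C of vertices. Send each vertex in C to its position in C, each
-- vertex v outside C to N(v) ∩ C read as a subset of C, and one extra point to
-- the empty subset. For an LD-code C this encoding is injective, so that
-- n + 1 ≤ |C| + 2^|C|; for a graph G^L(k) it is moreover onto, so that
-- k + 2^k ≤ n + 1. Since k + 2^k is strictly increasing in k, both the
-- minimality of C and the minimality of the density k/n follow; every LTD-code
-- being an LD-code, the same bounds serve the LTD case.
module Submission where

open import Defs
open import Data.Bool.Base using (Bool)
open import Data.Bool.Properties using (∧-identityʳ; ∧-zeroʳ)
open import Data.Fin.Base using (Fin; zero; suc)
open import Data.Fin.Properties using (2↔Bool; +↔⊎; *↔×; injective⇒≤; suc-injective)
  renaming (_≟_ to _≟F_)
open import Data.Fin.Subset using (Subset; inside; outside; ⊤; ⊥; _∈_; _∉_; _⊆_; _∩_; ⁅_⁆; ∣_∣; Nonempty)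
open import Data.Fin.Subset.Properties using (_∈?_; nonempty?; Empty-unique;
  ∈⊤; ∉⊥; x∈⁅x⁆; x∈⁅y⁆⇒x≡y;
  x∈p∩q⁺; x∈p∩q⁻; x∈p∪q⁺; x∈p∪q⁻; ∩-zeroˡ; ∣p∣≤n)
import Data.Integer.Base as ℤ
import Data.Integer.Properties as ℤₚ
open import Data.Nat.Base using (ℕ; zero; suc; _+_; _^_; _≤_; _<_; NonZero; z<s; s<s; s≤s⁻¹; >-nonZero)
open import Data.Nat.Properties using (≤-trans; ≤-antisym; <⇒≤; ≮⇒≥; ≤⇒≯; +-mono-<; ^-monoʳ-<)
open import Data.Product.Base using (∃; _×_; _,_; proj₁; proj₂)
open import Data.Product.Function.NonDependent.Propositional using (_×-↔_)
import Data.Rational.Base as ℚ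
open import Data.Rational.Properties using (toℚᵘ-cancel-≤; toℚᵘ-fromℚᵘ)
import Data.Rational.Unnormalised.Base as ℚᵘ
import Data.Rational.Unnormalised.Properties as ℚᵘₚ
open import Data.Sum.Base using (_⊎_; inj₁; inj₂)
open import Data.Sum.Function.Propositional using (_⊎-↔_)
open import Data.Sum.Properties using (inj₁-injective; inj₂-injective)
open import Data.Vec.Base using ([]; _∷_; here; there; uncons)
open import Data.Vec.Properties using ([]=⇒lookup; lookup⇒[]=; lookup∘tabulate; ∷-injective)
open import Function.Base using (_∘_)
open import Function.Bundles using (_↔_; _⇔_; mk⇔; mk↔ₛ′; module Injection)
open import Function.Construct.Composition using (_↔-∘_)
open import Function.Construct.Symmetry using (↔-sym)
open import Function.Definitions using (Injective; StrictlySurjective)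
open import Function.Properties.Inverse using (↔⇒↣; ↔-refl)
open import Relation.Binary.PropositionalEquality
open import Relation.Nullary using (yes; no; contradiction)
open import Relation.Nullary.Decidable using (does; dec-true; decidable-stable)

private variable
  n k : ℕ

-- Counting subsets and comparing fractions.

Subset↔Fin : ∀ n → Subset n ↔ Fin (2 ^ n)
Subset↔Fin zero    = mk↔ₛ′ (λ _ → zero) (λ _ → []) (λ { zero → refl }) (λ { [] → refl })
Subset↔Fin (suc n) = ↔-sym *↔× ↔-∘ ((↔-sym 2↔Bool ×-↔ Subset↔Fin n) ↔-∘ uncons↔)
  where
  uncons↔ : Subset (suc n) ↔ (Bool × Subset n)
  uncons↔ = mk↔ₛ′ uncons (λ { (x , p) → x ∷ p }) (λ _ → refl) (λ { (_ ∷ _) → refl })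

-- Turns injections into or out of the code space into inequalities between natural numbers.
⊎Subset↔Fin : ∀ m n → (Fin m ⊎ Subset n) ↔ Fin (m + 2 ^ n)
⊎Subset↔Fin m n = ↔-sym +↔⊎ ↔-∘ (↔-refl ⊎-↔ Subset↔Fin n)

n+2^n-cancel-≤ : ∀ m n → m + 2 ^ m ≤ n + 2 ^ n → m ≤ n
n+2^n-cancel-≤ m n le =
  ≮⇒≥ λ n<m → ≤⇒≯ le (+-mono-< n<m (^-monoʳ-< 2 (s<s z<s) n<m))

-- `ℚ._/_` reduces to lowest terms, so the comparison passes through unnormalised fractions, where
-- cross-multiplication leaves `k * n ≤ k * m`.
/-monoʳ-≤ : ∀ k {m n} .{{_ : NonZero m}} .{{_ : NonZero n}} → n ≤ m →
            ℤ.+ k ℚ./ m ℚ.≤ ℤ.+ k ℚ./ n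
/-monoʳ-≤ k {suc m} {suc n} n≤m = toℚᵘ-cancel-≤ (begin
  ℚ.toℚᵘ (ℤ.+ k ℚ./ suc m)  ≃⟨ toℚᵘ-fromℚᵘ (ℚᵘ.mkℚᵘ (ℤ.+ k) m) ⟩
  ℚᵘ.mkℚᵘ (ℤ.+ k) m         ≤⟨ ℚᵘ.*≤* (ℤₚ.*-monoˡ-≤-nonNeg (ℤ.+ k) (ℤ.+≤+ n≤m)) ⟩
  ℚᵘ.mkℚᵘ (ℤ.+ k) n         ≃⟨ toℚᵘ-fromℚᵘ (ℚᵘ.mkℚᵘ (ℤ.+ k) n) ⟨
  ℚ.toℚᵘ (ℤ.+ k ℚ./ suc n)  ∎)
  where open ℚᵘₚ.≤-Reasoning

-- Subsets of `C` as bit vectors of length `∣ C ∣`.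

enum-∈ : (C : Subset n) (i : Fin ∣ C ∣) → enum C i ∈ C
enum-∈ (inside  ∷ C) zero    = here
enum-∈ (inside  ∷ C) (suc i) = there (enum-∈ C i)
enum-∈ (outside ∷ C) i       = there (enum-∈ C i)

enum-injective : (C : Subset n) → Injective _≡_ _≡_ (enum C)
enum-injective (inside  ∷ C) {zero}  {zero}  eq = refl
enum-injective (inside  ∷ C) {suc _} {suc _} eq =
  cong suc (enum-injective C (suc-injective eq))
enum-injective (outside ∷ C) eq = enum-injective C (suc-injective eq)

enum-surjective : (C : Subset n) {v : Fin n} → v ∈ C → ∃ λ i → enum C i ≡ v
enum-surjective (inside ∷ C) here = zero , refl
enum-surjective (inside ∷ C) (there v∈C) with i , refl ← enum-surjective C v∈C = suc i , refl
enum-surjective (outside ∷ C) (there v∈C) with i , refl ← enum-surjective C v∈C = i , refl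

-- The preimage under `enum C`; `extend` below is the image.
restrict : (C : Subset n) → Subset n → Subset ∣ C ∣
restrict []            []      = []
restrict (inside  ∷ C) (x ∷ p) = x ∷ restrict C p
restrict (outside ∷ C) (x ∷ p) = restrict C p

extend : (C : Subset n) → Subset ∣ C ∣ → Subset n
extend []            []      = []
extend (inside  ∷ C) (x ∷ s) = x ∷ extend C s
extend (outside ∷ C) s       = outside ∷ extend C s

restrict-extend : (C : Subset n) (s : Subset ∣ C ∣) → restrict C (extend C s) ≡ s
restrict-extend []            []      = refl
restrict-extend (inside  ∷ C) (x ∷ s) = cong (x ∷_) (restrict-extend C s)
restrict-extend (outside ∷ C) s       = restrict-extend C s

extend-⊆ : (C : Subset n) (s : Subset ∣ C ∣) → extend C s ⊆ C
extend-⊆ (inside  ∷ C) (x ∷ s) here      = here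
extend-⊆ (inside  ∷ C) (x ∷ s) (there p) = there (extend-⊆ C s p)
extend-⊆ (outside ∷ C) s       (there p) = there (extend-⊆ C s p)

restrict-∩ : (C p : Subset n) → restrict C (p ∩ C) ≡ restrict C p
restrict-∩ []            []      = refl
restrict-∩ (inside  ∷ C) (x ∷ p) = cong₂ _∷_ (∧-identityʳ x) (restrict-∩ C p)
restrict-∩ (outside ∷ C) (x ∷ p) = restrict-∩ C p

-- Carries equality of codes back to equality of traces on `C`, the form in which location
-- separation is stated.
restrict-≡⇒∩-≡ : (C p q : Subset n) → restrict C p ≡ restrict C q → p ∩ C ≡ q ∩ C
restrict-≡⇒∩-≡ []            []      []      eq = refl
restrict-≡⇒∩-≡ (inside  ∷ C) (x ∷ p) (y ∷ q) eq with refl , eq′ ← ∷-injective eq =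
  cong (_ ∷_) (restrict-≡⇒∩-≡ C p q eq′)
restrict-≡⇒∩-≡ (outside ∷ C) (x ∷ p) (y ∷ q) eq =
  cong₂ _∷_ (trans (∧-zeroʳ x) (sym (∧-zeroʳ y))) (restrict-≡⇒∩-≡ C p q eq)

-- Neighborhoods and domination.

module _ (G : Graph n) where
  open Graph G hiding (NoIsolated)

  ~⇒∈N : ∀ {v w} → v ~ w → w ∈ N v
  ~⇒∈N {v} {w} v~w =
    lookup⇒[]= w _ (trans (lookup∘tabulate _ w) (dec-true (v ~? w) v~w))

  ∈N⇒~ : ∀ {v w} → w ∈ N v → v ~ w
  ∈N⇒~ {v} {w} w∈N
    with v ~? w | trans (sym (lookup∘tabulate (does ∘ (v ~?_)) w)) ([]=⇒lookup w∈N)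
  ... | yes v~w | _  = v~w
  ... | no  _   | ()

module _ (G : Graph n) where
  open Graph G hiding (NoIsolated)

  -- The dominating vertex lies in `C`, hence is not `v` itself.
  N[]∩⇒N∩ : ∀ {C v} → v ∉ C → Nonempty (N[ v ] ∩ C) → Nonempty (N v ∩ C)
  N[]∩⇒N∩ {C} {v} v∉C (w , w∈)
    with w∈N[v] , w∈C ← x∈p∩q⁻ N[ v ] C w∈ | x∈p∪q⁻ (N v) ⁅ v ⁆ w∈N[v]
  ... | inj₁ w∈N = w , x∈p∩q⁺ (w∈N , w∈C)
  ... | inj₂ w∈v with refl ← x∈⁅y⁆⇒x≡y v w∈v = contradiction w∈C v∉C

  N∩⇒N[]∩ : ∀ {C} v → Nonempty (N v ∩ C) → Nonempty (N[ v ] ∩ C)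
  N∩⇒N[]∩ {C} v (w , w∈) with w∈N , w∈C ← x∈p∩q⁻ (N v) C w∈ =
    w , x∈p∩q⁺ (x∈p∪q⁺ (inj₁ w∈N) , w∈C)

  LTD⇒LD : ∀ {C} → IsCode LTD G C → IsCode LD G C
  LTD⇒LD (sep , tot) = sep , λ v → N∩⇒N[]∩ v (tot v)

  -- The whole vertex set serves as the code: it separates vacuously and meets every non-empty
  -- neighborhood. Conversely, total domination gives each vertex a neighbor.
  NoIsolated⇔LTD-admissible : NoIsolated G ⇔ Admissible LTD G
  NoIsolated⇔LTD-admissible = mk⇔
    (λ iso → ⊤ , (λ {u v} u∉⊤ → contradiction ∈⊤ u∉⊤) ,
             λ v → let (w , w∈N) = decidable-stable (nonempty? (N v)) (iso v)
                   in w , x∈p∩q⁺ (w∈N , ∈⊤))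
    (λ { (C , _ , tot) v iso → let (w , w∈) = tot v in iso (w , proj₁ (x∈p∩q⁻ (N v) C w∈)) })

  -- The encoding and its two counting bounds.

  module _ (C : Subset n) where

    -- Here `zero` is the extra point. Since `restrict C` ignores what lies outside `C`, `N v` can
    -- stand for `N v ∩ C`.
    encode : Fin (suc n) → Fin ∣ C ∣ ⊎ Subset ∣ C ∣
    encode zero = inj₂ (restrict C ⊥)
    encode (suc v) with v ∈? C
    ... | yes v∈C = inj₁ (proj₁ (enum-surjective C v∈C))
    ... | no  _   = inj₂ (restrict C (N v))

    -- Separation keeps the vertices outside `C` apart from one another; domination makes their
    -- traces non-empty, which keeps them apart from the extra point.
    encode-injective : IsCode LD G C → Injective _≡_ _≡_ encode
    encode-injective (sep , dom) = inj _ _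
      where
      ⊥≢N : ∀ {v} → v ∉ C → restrict C ⊥ ≢ restrict C (N v)
      ⊥≢N {v} v∉C eq = ∉⊥ (proj₂ (subst Nonempty (sym ⊥≡) (N[]∩⇒N∩ v∉C (dom v))))
        where
        ⊥≡ : ⊥ ≡ N v ∩ C
        ⊥≡ = trans (sym (∩-zeroˡ C)) (restrict-≡⇒∩-≡ C ⊥ (N v) eq)

      inj : ∀ x y → encode x ≡ encode y → x ≡ y
      inj zero zero _ = refl
      inj zero (suc v) eq with v ∈? C
      ... | no v∉C = contradiction (inj₂-injective eq) (⊥≢N v∉C)
      inj (suc u) zero eq with u ∈? C
      ... | no u∉C = contradiction (sym (inj₂-injective eq)) (⊥≢N u∉C)
      inj (suc u) (suc v) eq with u ∈? C | v ∈? C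
      ... | yes u∈C | yes v∈C = cong suc
        (trans (sym (proj₂ (enum-surjective C u∈C)))
        (trans (cong (enum C) (inj₁-injective eq)) (proj₂ (enum-surjective C v∈C))))
      ... | no u∉C | no v∉C = cong suc (decidable-stable (u ≟F v) λ u≢v →
        sep u∉C v∉C u≢v (restrict-≡⇒∩-≡ C (N u) (N v) (inj₂-injective eq)))

    LD-bound : IsCode LD G C → n < ∣ C ∣ + 2 ^ ∣ C ∣
    -- The goal unfolds to `suc n ≤ _`, so the extra point accounts for the strictness.
    LD-bound code = injective⇒≤
      (encode-injective code ∘ Injection.injective (↔⇒↣ (⊎Subset↔Fin ∣ C ∣ ∣ C ∣)))

    module _ (GL : IsGL k G C) where
      open IsGL GL

      GL-LD : IsCode LD G C
      GL-LD = sep , dom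
        where
        sep : LocationSeparating C
        sep {u} {v} u∉C v∉C u≢v eq
          -- Both `u` and `v` have the trace `N u ∩ C`, so both equal its unique vertex.
          with _ , _ , uniq ← unique-v (N u ∩ C) (proj₂ ∘ x∈p∩q⁻ (N u) C) (exhausted u u∉C) =
          u≢v (trans (sym (uniq (u∉C , refl))) (uniq (v∉C , sym eq)))

        dom : Dominating C
        dom v with v ∈? C
        ... | yes v∈C = v , x∈p∩q⁺ (x∈p∪q⁺ (inj₂ (x∈⁅x⁆ v)) , v∈C)
        ... | no  v∉C = N∩⇒N[]∩ v (exhausted v v∉C)

      GL-LTD : NoIsolated (induced G C) → IsCode LTD G C
      GL-LTD iso = proj₁ GL-LD , tot
        where
        tot : TotalDominating C
        tot v with v ∈? C
        ... | no  v∉C = exhausted v v∉C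
        ... | yes v∈C
          -- A vertex of `C` finds its neighbor in `C` through the induced subgraph.
          with i , refl ← enum-surjective C v∈C
          with j , j∈ ← decidable-stable (nonempty? _) (iso i) =
          enum C j , x∈p∩q⁺ (~⇒∈N G (∈N⇒~ (induced G C) j∈) , enum-∈ C j)

      encode-surjective : StrictlySurjective _≡_ encode
      encode-surjective (inj₁ i) = suc (enum C i) , eq
        where
        eq : encode (suc (enum C i)) ≡ inj₁ i
        eq with enum C i ∈? C
        -- The index recovered from `enum C i` could a priori differ from `i`.
        ... | yes p  = cong inj₁ (enum-injective C (proj₂ (enum-surjective C p)))
        ... | no  ∉C = contradiction (enum-∈ C i) ∉C
      encode-surjective (inj₂ s) with nonempty? (extend C s)
      -- The empty trace belongs to no vertex outside `C`; the extra point supplies it.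
      ... | no  empty = zero , cong inj₂
        (trans (cong (restrict C) (sym (Empty-unique empty))) (restrict-extend C s))
      ... | yes ne with v , (v∉C , N∩C≡) , _ ← unique-v (extend C s) (extend-⊆ C s) ne = suc v , eq
        where
        eq : encode (suc v) ≡ inj₂ s
        eq with v ∈? C
        ... | yes v∈C = contradiction v∈C v∉C
        ... | no  _   = cong inj₂ (trans (sym (restrict-∩ C (N v)))
                          (trans (cong (restrict C) N∩C≡) (restrict-extend C s)))

      -- A choice of preimages under the surjective encoding is an injection the other way.
      GL-bound : ∣ C ∣ + 2 ^ ∣ C ∣ ≤ suc n
      GL-bound = injective⇒≤
        (Injection.injective (↔⇒↣ (↔-sym (⊎Subset↔Fin ∣ C ∣ ∣ C ∣))) ∘ section-injective)
        where
        section-injective : Injective _≡_ _≡_ (proj₁ ∘ encode-surjective)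
        section-injective {x} {y} eq = trans (sym (proj₂ (encode-surjective x)))
          (trans (cong encode eq) (proj₂ (encode-surjective y)))

-- Minimum codes and minimum density.

IsCode⇒LD : ∀ X (G : Graph n) {C} → IsCode X G C → IsCode LD G C
IsCode⇒LD LD  G code = code
IsCode⇒LD LTD G code = LTD⇒LD G code

HasNumber-unique : ∀ X (G : Graph n) {γ δ} → HasNumber X G γ → HasNumber X G δ → γ ≡ δ
HasNumber-unique X G (C , (C-code , C-min) , refl) (D , (D-code , D-min) , refl) =
  ≤-antisym (C-min D D-code) (D-min C C-code)

module _ (X : CodeKind) (G : Graph n) {C : Subset n} (GL : IsGL k G C) (code : IsCode X G C) where

  GL-minimum : IsMinimumCode X G C
  GL-minimum = code , λ D D-code →
    -- Both bounds meet at `suc n`.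
    n+2^n-cancel-≤ ∣ C ∣ ∣ D ∣ (≤-trans (GL-bound G C GL) (LD-bound G D (IsCode⇒LD X G D-code)))

  GL-attains : 1 ≤ k → AttainsMinimumDensity X k G
  GL-attains 1≤k =
    (C , code) , number , _ , (k , number , n≢0 , refl) ,
    -- The density of `H` comes with its own X-number `γ`, which uniqueness identifies with `k`.
    λ { H _ H-number _ (γ , H-number′ , m≢0 , refl) →
        density-≤ H H-number (HasNumber-unique X H H-number H-number′) m≢0 }
    where
    open IsGL GL using (size)

    number : HasNumber X G k
    number = C , GL-minimum , size

    n≢0 : NonZero n
    n≢0 = >-nonZero (≤-trans 1≤k (subst (_≤ n) size (∣p∣≤n C)))

    -- Equal X-numbers give `m < k + 2 ^ k ≤ suc n`, so `G` has the largest order and thus the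
    -- smallest density.
    order-≤ : ∀ {m} (H : Graph m) → HasNumber X H k → m ≤ n
    order-≤ H (D , (D-code , _) , ∣D∣≡k) = s≤s⁻¹ (≤-trans
      (subst (λ d → _ < d + 2 ^ d) (trans ∣D∣≡k (sym size)) (LD-bound H D (IsCode⇒LD X H D-code)))
      (GL-bound G C GL))

    density-≤ : ∀ {m γ} (H : Graph m) → HasNumber X H k → k ≡ γ → (m≢0 : NonZero m) →
                ℚ._/_ (ℤ.+ k) n {{n≢0}} ℚ.≤ ℚ._/_ (ℤ.+ γ) m {{m≢0}}
    density-≤ H H-number refl m≢0 = /-monoʳ-≤ k {{n≢0}} {{m≢0}} (order-≤ H H-number)

theorem1 : ∀ (k : ℕ) → 2 ≤ k →
    ∀ {n : ℕ} (G : Graph n) (C : Subset n) → IsGL k G C →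
    IsMinimumCode LD G C
    × (NoIsolated (induced G C) ⇔ Admissible LTD (induced G C))
    × (NoIsolated (induced G C) → IsMinimumCode LTD G C)
    × AttainsMinimumDensity LD k G
    × (NoIsolated (induced G C) → AttainsMinimumDensity LTD k G)
theorem1 k 2≤k G C GL =
  GL-minimum LD G GL LD-code ,
  NoIsolated⇔LTD-admissible (induced G C) ,
  (λ iso → GL-minimum LTD G GL (GL-LTD G C GL iso)) ,
  GL-attains LD G GL LD-code 1≤k ,
  λ iso → GL-attains LTD G GL (GL-LTD G C GL iso) 1≤k
  where
  LD-code : IsCode LD G C
  LD-code = GL-LD G C GL

  1≤k : 1 ≤ k
  1≤k = <⇒≤ 2≤k
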